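{- A tree $T$ is $\chi_\rho$-critical if and only if it is $\chi_\rho$-vertex-critical.
   Context: A $k$-packing coloring of a graph $G$ is a map $c:V(G)\to\{1,\ldots,k\}$ such that two distinct vertices $u,v$ with $c(u)=c(v)=i$ satisfy $d_G(u,v)>i$ (distance between vertices in different components is infinite); $\chi_\rho(G)$ is the smallest $k$ for which such a coloring exists. $G$ is $\chi_\rho$-critical if $\chi_\rho(H)<\chi_\rho(G)$ for every proper subgraph $H$ of $G$; $G$ is $\chi_\rho$-vertex-critical if $\chi_\rho(G-x)<\chi_\rho(G)$ for every vertex $x\in V(G)$. -}

module Defs where

open import Data.Nat.Base using (ℕ; zero; suc; _+_; _^_; _≤_; _<_; z≤n; s≤s)
open import Data.Nat.Properties using (≤-trans; ≮⇒≥; <⇒≱; anyUpTo?; allUpTo?; suc-injective)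
import Data.Nat.Properties as ℕ
open import Data.Nat.Induction using (<-rec)
open import Data.Fin.Base using (Fin; zero; suc; inject₁; fromℕ; fromℕ<; toℕ; finToFun; funToFin)
open import Data.Fin.Properties using (any?; all?; toℕ<n; toℕ-fromℕ<; toℕ-injective; finToFun-funToFin)
import Data.Fin.Properties as Fin
open import Data.Fin.Subset using (Subset; _∈_; _⊆_; Nonempty) renaming (_-_ to _∖_)
open import Data.Fin.Subset.Properties using (_∈?_; x∈p∧x≢y⇒x∈p-y)
open import Data.Product using (∃; ∃-syntax; _×_; _,_; proj₁; proj₂)
open import Function.Base using (_∘_)
open import Function.Definitions using (Injective)
open import Level using (0ℓ)
open import Relation.Binary using (Rel; Symmetric; Decidable)
open import Relation.Binary.PropositionalEquality using (_≡_; _≢_; refl; sym; trans; cong; subst)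
open import Relation.Nullary using (¬_; Dec; yes; no; ¬?; contradiction)
open import Relation.Nullary.Decidable using (map′; _×-dec_; _→-dec_)
import Relation.Unary as U

-- Finite simple graphs whose vertex set is a subset of the ambient set
-- Fin n, so that a graph and its subgraphs live in the same type.  The empty
-- graph is allowed.

record Graph (n : ℕ) : Set₁ where
  field
    V        : Subset n
    Adj      : Rel (Fin n) 0ℓ
    Adj?     : Decidable Adj
    Adj-sym  : Symmetric Adj
    Adj-irr  : ∀ {u} → ¬ Adj u u
    Adj⇒∈V   : ∀ {u v} → Adj u v → u ∈ V

open Graph public

private variable
  n : ℕ

infix 4 _⊑_ _⊏_

_⊑_ : Graph n → Graph n → Set
H ⊑ G = V H ⊆ V G × (∀ {u v} → Adj H u v → Adj G u v)

-- Proper subgraph: a subgraph that differs from G in vertices or edges.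
_⊏_ : Graph n → Graph n → Set
H ⊏ G = H ⊑ G × ¬ (G ⊑ H)

infixl 6 _-_

_-_ : Graph n → Fin n → Graph n
G - x = record
  { V       = V G ∖ x
  ; Adj     = λ u v → Adj G u v × u ≢ x × v ≢ x
  ; Adj?    = λ u v → Adj? G u v ×-dec ¬? (u Fin.≟ x) ×-dec ¬? (v Fin.≟ x)
  ; Adj-sym = λ (uv , u≢x , v≢x) → Adj-sym G uv , v≢x , u≢x
  ; Adj-irr = Adj-irr G ∘ proj₁
  ; Adj⇒∈V  = λ (uv , u≢x , _) → x∈p∧x≢y⇒x∈p-y (Adj⇒∈V G uv) u≢x
  }

data Walk (G : Graph n) : Fin n → Fin n → ℕ → Set where
  []  : ∀ {u} → u ∈ V G → Walk G u u 0
  _∷_ : ∀ {u v w ℓ} → Adj G u v → Walk G v w ℓ → Walk G u w (suc ℓ)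

Connected : Graph n → Set
Connected G = ∀ {u v} → u ∈ V G → v ∈ V G → ∃ (Walk G u v)

record Cycle (G : Graph n) : Set where
  field
    {k}      : ℕ
    vertex   : Fin (3 + k) → Fin n
    distinct : Injective _≡_ _≡_ vertex
    step     : ∀ (i : Fin (2 + k)) → Adj G (vertex (inject₁ i)) (vertex (suc i))
    close    : Adj G (vertex (fromℕ (2 + k))) (vertex zero)

record IsTree (G : Graph n) : Set where
  field
    nonempty  : Nonempty (V G)
    connected : Connected G
    acyclic   : ¬ Cycle G

IsLeast : (ℕ → Set) → ℕ → Set
IsLeast P m = P m × (∀ k → P k → m ≤ k)

IsDistance : Graph n → Fin n → Fin n → ℕ → Set
IsDistance G u v = IsLeast (Walk G u v)

-- d_G(u,v) > i.  There is no d with IsDistance G u v d when u and v lie in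
-- different components, so infinite distance exceeds every i.
Distance> : Graph n → Fin n → Fin n → ℕ → Set
Distance> G u v i = ∀ d → IsDistance G u v d → i < d

-- A map V(G) → {1,…,k} is given by a function on the whole of Fin n; its values
-- outside V(G) are unconstrained.
record IsPackingColoring (G : Graph n) (k : ℕ) (c : Fin n → ℕ) : Set where
  field
    range   : ∀ v → v ∈ V G → 1 ≤ c v × c v ≤ k
    packing : ∀ u v → u ∈ V G → v ∈ V G → u ≢ v → c u ≡ c v → Distance> G u v (c u)

PackingColorable : Graph n → ℕ → Set
PackingColorable G k = ∃[ c ] IsPackingColoring G k c

least : {P : ℕ → Set} → U.Decidable P → ∀ m → P m → ∃ (IsLeast P)
least {P} P? = <-rec (λ m → P m → ∃ (IsLeast P)) go
  where
  go : ∀ m → (∀ {k} → k < m → P k → ∃ (IsLeast P)) → P m → ∃ (IsLeast P)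
  go m rec pm with anyUpTo? P? m
  ... | yes (k , k<m , pk) = rec k<m pk
  ... | no none            = m , pm , λ k pk → ≮⇒≥ λ k<m → none (k , k<m , pk)

walk? : (G : Graph n) → ∀ u v → U.Decidable (Walk G u v)
walk? G u v zero with u Fin.≟ v
... | yes refl = map′ [] (λ { ([] u∈V) → u∈V }) (u ∈? V G)
... | no u≢v   = no λ { ([] _) → u≢v refl }
walk? G u v (suc ℓ) =
  map′ (λ (_ , a , p) → a ∷ p) (λ { (a ∷ p) → _ , a , p })
       (any? λ w → Adj? G u w ×-dec walk? G w v ℓ)

distance>? : (G : Graph n) → ∀ u v → U.Decidable (Distance> G u v)
distance>? G u v i = map′ to from (allUpTo? (¬? ∘ walk? G u v) (suc i))
  where
  to : (∀ {ℓ} → ℓ < suc i → ¬ Walk G u v ℓ) → Distance> G u v i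
  to none d (p , _) = ℕ.≰⇒> λ d≤i → none (s≤s d≤i) p
  from : Distance> G u v i → ∀ {ℓ} → ℓ < suc i → ¬ Walk G u v ℓ
  from far {ℓ} (s≤s ℓ≤i) p =
    let d , isD = least (walk? G u v) ℓ p
    in <⇒≱ (far d isD) (≤-trans (proj₂ isD ℓ p) ℓ≤i)

isPackingColoring? : (G : Graph n) → ∀ k c → Dec (IsPackingColoring G k c)
isPackingColoring? G k c =
  map′ (λ (r , p) → record { range = r ; packing = p })
       (λ pc → IsPackingColoring.range pc , IsPackingColoring.packing pc)
       ((all? λ v → (v ∈? V G) →-dec ((1 ℕ.≤? c v) ×-dec (c v ℕ.≤? k)))
         ×-dec
        (all? λ u → all? λ v → (u ∈? V G) →-dec ((v ∈? V G) →-dec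
          (¬? (u Fin.≟ v) →-dec ((c u ℕ.≟ c v) →-dec distance>? G u v (c u))))))

isPackingColoring-cong : (G : Graph n) → ∀ {k c c′} → (∀ v → v ∈ V G → c v ≡ c′ v) →
                         IsPackingColoring G k c → IsPackingColoring G k c′
isPackingColoring-cong G {k} eq pc = record
  { range   = λ v v∈ → subst (λ i → 1 ≤ i × i ≤ k) (eq v v∈) (range v v∈)
  ; packing = λ u v u∈ v∈ u≢v same → subst (Distance> G u v) (eq u u∈)
      (packing u v u∈ v∈ u≢v (trans (eq u u∈) (trans same (sym (eq v v∈)))))
  }
  where open IsPackingColoring pc

packingColorable? : (G : Graph n) → U.Decidable (PackingColorable G)
packingColorable? {n} G k =
  map′ (λ (i , pc) → decode i , pc) encode (any? λ i → isPackingColoring? G k (decode i))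
  where
  decode : Fin (suc k ^ n) → Fin n → ℕ
  decode i = toℕ ∘ finToFun i
  encode : PackingColorable G k → ∃[ i ] IsPackingColoring G k (decode i)
  encode (c , pc) = funToFin f , isPackingColoring-cong G eq pc
    where
    open IsPackingColoring pc
    f : Fin n → Fin (suc k)
    f v with c v ℕ.≤? k
    ... | yes cv≤k = fromℕ< (s≤s cv≤k)
    ... | no _     = zero
    toℕ-f : ∀ v → c v ≤ k → toℕ (f v) ≡ c v
    toℕ-f v cv≤k with c v ℕ.≤? k
    ... | yes p = toℕ-fromℕ< (s≤s p)
    ... | no ¬p = contradiction cv≤k ¬p
    eq : ∀ v → v ∈ V G → c v ≡ decode (funToFin f) v
    eq v v∈ = sym (trans (cong toℕ (finToFun-funToFin f v)) (toℕ-f v (proj₂ (range v v∈))))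

packingColorable-n : (G : Graph n) → PackingColorable G n
packingColorable-n G = suc ∘ toℕ , record
  { range   = λ v _ → s≤s z≤n , toℕ<n v
  ; packing = λ u v _ _ u≢v same → contradiction (toℕ-injective (suc-injective same)) u≢v
  }

packingNumber : (G : Graph n) → ∃ (IsLeast (PackingColorable G))
packingNumber {n} G = least (packingColorable? G) n (packingColorable-n G)

χρ : Graph n → ℕ
χρ G = proj₁ (packingNumber G)

χρ-isLeast : (G : Graph n) → IsLeast (PackingColorable G) (χρ G)
χρ-isLeast G = proj₂ (packingNumber G)

Critical : Graph n → Set₁
Critical {n} G = ∀ (H : Graph n) → H ⊏ G → χρ H < χρ G

VertexCritical : Graph n → Set
VertexCritical G = ∀ x → x ∈ V G → χρ (G - x) < χρ G

{-# OPTIONS --safe #-}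

-- Only the direction from vertex-criticality needs an argument.  A proper
-- subgraph H of T misses a vertex x, and then H ⊑ T - x, or it misses an edge
-- xy, and then H ⊑ T - xy.  In the second case no component of T - xy contains
-- both x and y, since T is acyclic, and each contains one of them, since T is
-- connected.  So each component lies in T - y or in T - x, and using a colouring
-- of T - y on the component of x and one of T - x on the component of y gives
-- χρ (T - xy) ≤ χρ (T - x) ⊔ χρ (T - y) < χρ T.

module Submission where

open import Defs
open import Data.Nat.Base using (ℕ; suc; _≤_; _<_; _⊔_)
open import Data.Nat.Properties using (≤-refl; ≤-trans; ≤-<-trans; <-≤-trans; <⇒≱; ≤-pred; n≤1+n; m≤m⊔n; m≤n⊔m; ⊔-pres-<m)
open import Data.Fin.Base using (Fin; zero; suc; inject₁; fromℕ)
open import Data.Fin.Properties using (any?; _≟_)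
open import Data.Fin.Subset using (_∈_)
open import Data.Fin.Subset.Properties using (_∈?_; x∈p∧x≢y⇒x∈p-y; x∈p⇒p-x⊂p)
open import Data.Product using (∃; ∃-syntax; _×_; _,_; proj₁; proj₂)
open import Data.Sum using (_⊎_; inj₁; inj₂)
import Data.Sum as Sum
open import Function.Base using (_∘_; id)
open import Function.Bundles using (_⇔_; mk⇔)
open import Function.Definitions using (Injective)
open import Relation.Binary.PropositionalEquality using (_≡_; _≢_; refl; sym; cong; subst)
open import Relation.Nullary using (¬_; yes; no; ¬?; contradiction)
open import Relation.Nullary.Decidable using (_×-dec_; decidable-stable)

private variable
  n ℓ m k : ℕ
  G H : Graph n
  u v w x y : Fin n

-- Walks and reachability

start∈V : Walk G u v ℓ → u ∈ V G
start∈V         ([] u∈V) = u∈V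
start∈V {G = G} (a ∷ _)  = Adj⇒∈V G a

walk-mono : H ⊑ G → Walk H u v ℓ → Walk G u v ℓ
walk-mono (V⊆ , _)     ([] u∈V) = [] (V⊆ u∈V)
walk-mono H⊑G@(_ , A⊆) (a ∷ p)  = A⊆ a ∷ walk-mono H⊑G p

Reach : Graph n → Fin n → Fin n → Set
Reach G u v = ∃ (Walk G u v)

reach-refl : u ∈ V G → Reach G u u
reach-refl u∈V = 0 , [] u∈V

reach-step : Adj G u v → Reach G v w → Reach G u w
reach-step a (_ , p) = _ , a ∷ p

reach-trans : Reach G u v → Reach G v w → Reach G u w
reach-trans (_ , [] _)  r = r
reach-trans (_ , a ∷ p) r = reach-step a (reach-trans (_ , p) r)

reach-sym : Reach G u v → Reach G v u
reach-sym         (_ , [] u∈V) = reach-refl u∈V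
reach-sym {G = G} (_ , a ∷ p)  =
  reach-trans (reach-sym (_ , p)) (reach-step (Adj-sym G a) (reach-refl (Adj⇒∈V G a)))

-- Vertices along a shortest walk

vertexAt : {G : Graph n} {u v : Fin n} → Walk G u v ℓ → Fin (suc ℓ) → Fin n
vertexAt {u = u} _       zero    = u
vertexAt         (_ ∷ p) (suc i) = vertexAt p i

vertexAt-step : (p : Walk G u v ℓ) (i : Fin ℓ) → Adj G (vertexAt p (inject₁ i)) (vertexAt p (suc i))
vertexAt-step (a ∷ [] _)    zero    = a
vertexAt-step (a ∷ (_ ∷ _)) zero    = a
vertexAt-step (_ ∷ p)       (suc i) = vertexAt-step p i

vertexAt-last : (p : Walk G u v ℓ) → vertexAt p (fromℕ ℓ) ≡ v
vertexAt-last ([] _)  = refl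
vertexAt-last (_ ∷ p) = vertexAt-last p

walk-from : (p : Walk G u v ℓ) (i : Fin (suc ℓ)) → ∃[ m ] m ≤ ℓ × Walk G (vertexAt p i) v m
walk-from p       zero    = _ , ≤-refl , p
walk-from (_ ∷ p) (suc i) with walk-from p i
... | m , m≤ℓ , q = m , ≤-trans m≤ℓ (n≤1+n _) , q

-- If the start recurs later, the walk from the recurrence onwards is strictly shorter and has the
-- same ends. A repetition that does not involve the start lies in the tail, which is again
-- shortest.
shortest-injective : (p : Walk G u v ℓ) → (∀ m → Walk G u v m → ℓ ≤ m) →
                     Injective _≡_ _≡_ (vertexAt p)
shortest-injective p       _     {zero}  {zero}  _  = refl
shortest-injective {G = G} {v = v} (_ ∷ p) short {zero} {suc j} eq with walk-from p j
... | m , m≤ℓ , q = contradiction m≤ℓ (<⇒≱ (short m (subst (λ z → Walk G z v m) (sym eq) q)))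
shortest-injective (a ∷ p) short {suc i} {zero}  eq =
  sym (shortest-injective (a ∷ p) short {zero} {suc i} (sym eq))
shortest-injective (a ∷ p) short {suc i} {suc j} eq =
  cong suc (shortest-injective p (λ m q → ≤-pred (short (suc m) (a ∷ q))) eq)

-- Deleting a vertex or an edge

G-x⊏G : (G : Graph n) → x ∈ V G → G - x ⊏ G
G-x⊏G G x∈V with x∈p⇒p-x⊂p x∈V
... | V-x⊆V , y , y∈V , y∉V-x = (V-x⊆V , proj₁) , λ (V⊆V-x , _) → y∉V-x (V⊆V-x y∈V)

⊑-deleteVertex : (H G : Graph n) → H ⊑ G → ¬ x ∈ V H → H ⊑ G - x
⊑-deleteVertex {x = x} H G (V⊆ , A⊆) x∉V =
    (λ u∈V → x∈p∧x≢y⇒x∈p-y (V⊆ u∈V) (avoids u∈V))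
  , (λ a → A⊆ a , avoids (Adj⇒∈V H a) , avoids (Adj⇒∈V H (Adj-sym H a)))
  where
  avoids : ∀ {u} → u ∈ V H → u ≢ x
  avoids u∈V refl = x∉V u∈V

deleteEdge : Graph n → Fin n → Fin n → Graph n
deleteEdge G x y = record
  { V       = V G
  ; Adj     = λ u v → Adj G u v × ¬ (u ≡ x × v ≡ y) × ¬ (u ≡ y × v ≡ x)
  ; Adj?    = λ u v → Adj? G u v ×-dec ¬? (u ≟ x ×-dec v ≟ y) ×-dec ¬? (u ≟ y ×-dec v ≟ x)
  ; Adj-sym = λ (a , ¬xy , ¬yx) → Adj-sym G a , (λ (p , q) → ¬yx (q , p)) , (λ (p , q) → ¬xy (q , p))
  ; Adj-irr = Adj-irr G ∘ proj₁
  ; Adj⇒∈V  = Adj⇒∈V G ∘ proj₁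
  }

deleteEdge⊑ : (G : Graph n) → deleteEdge G x y ⊑ G
deleteEdge⊑ G = id , proj₁

⊑-deleteEdge : (H G : Graph n) → H ⊑ G → ¬ Adj H x y → H ⊑ deleteEdge G x y
⊑-deleteEdge H G (V⊆ , A⊆) ¬xy =
  V⊆ , λ a → A⊆ a , (λ { (refl , refl) → ¬xy a }) , (λ { (refl , refl) → ¬xy (Adj-sym H a) })

-- Properness is only a negated inclusion, so the witness comes from a finite search. If both
-- searches fail, decidability of membership and adjacency turns the failure into `G ⊑ H`.
⊏-missing : (H G : Graph n) → H ⊏ G →
            (∃[ x ] x ∈ V G × ¬ x ∈ V H) ⊎ (∃[ x ] ∃[ y ] Adj G x y × ¬ Adj H x y)
⊏-missing H G (_ , G⋢H)
  with any? (λ x → x ∈? V G ×-dec ¬? (x ∈? V H))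
     | any? (λ x → any? λ y → Adj? G x y ×-dec ¬? (Adj? H x y))
... | yes vertex | _        = inj₁ vertex
... | no _       | yes edge = inj₂ edge
... | no ¬vertex | no ¬edge = contradiction
  ( (λ {x} x∈V → decidable-stable (x ∈? V H) λ x∉V → ¬vertex (x , x∈V , x∉V))
  , (λ {x} {y} a → decidable-stable (Adj? H x y) λ ¬a → ¬edge (x , y , a , ¬a)) ) G⋢H

-- A shortest walk from `x` to `y` has distinct vertices, so the deleted edge would close it to a
-- cycle of `G`.
deleteEdge-separates : (G : Graph n) → ¬ Cycle G → Adj G x y → ¬ Reach (deleteEdge G x y) x y
deleteEdge-separates {x = x} {y = y} G acyclic xy (ℓ , p)
  with least (walk? (deleteEdge G x y) x y) ℓ p
-- Length 0 would make `xy` a loop and length 1 would use the deleted edge itself. Any longer walk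
-- has the three or more vertices that `Cycle` demands.
... | _ , [] _ , _                  = Adj-irr G xy
... | _ , (_ , ¬xy , _) ∷ [] _ , _  = ¬xy (refl , refl)
... | _ , q@(_ ∷ (_ ∷ _)) , short   = acyclic record
  { vertex   = vertexAt q
  ; distinct = shortest-injective q short
  ; step     = λ i → proj₁ (vertexAt-step q i)
  ; close    = subst (λ z → Adj G z x) (sym (vertexAt-last q)) (Adj-sym G xy)
  }

-- Follow the walk only until it first meets `x` or `y`; up to there it survives the deletion.
deleteEdge-sides : (G : Graph n) → y ∈ V G → Walk G w x ℓ →
                   Reach (deleteEdge G x y) w x ⊎ Reach (deleteEdge G x y) w y
deleteEdge-sides G _ ([] x∈V) = inj₁ (reach-refl x∈V)
deleteEdge-sides {y = y} {w = w} {x = x} G y∈V (a ∷ p) with w ≟ x | w ≟ y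
... | yes refl | _        = inj₁ (reach-refl (Adj⇒∈V G a))
... | no _     | yes refl = inj₂ (reach-refl y∈V)
... | no w≢x   | no w≢y   = Sum.map (reach-step a′) (reach-step a′) (deleteEdge-sides G y∈V p)
  where
  -- In either orientation the deleted edge starts at `x` or `y`, and `w` is neither.
  a′ : Adj (deleteEdge G x y) w _
  a′ = a , w≢x ∘ proj₁ , w≢y ∘ proj₁

-- The walk never leaves the component of `x` in `H`, and `y` is outside it. Hence, within this
-- component, distances in `G - y` are at most those in `H`.
walk-avoiding : (G : Graph n) → H ⊑ G → ¬ Reach H x y → Reach H u x → Walk H u v ℓ → Walk (G - y) u v ℓ
walk-avoiding {H = H} {x = x} {y = y} G H⊑G x≁y = go
  where
  avoids : ∀ {u} → Reach H u x → u ≢ y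
  avoids u~x refl = x≁y (reach-sym u~x)
  go : ∀ {u v ℓ} → Reach H u x → Walk H u v ℓ → Walk (G - y) u v ℓ
  go u~x ([] u∈V) = [] (x∈p∧x≢y⇒x∈p-y (proj₁ H⊑G u∈V) (avoids u~x))
  go u~x (a ∷ p)  = (proj₂ H⊑G a , avoids u~x , avoids v~x) ∷ go v~x p
    where v~x = reach-trans (reach-step (Adj-sym H a) (reach-refl (Adj⇒∈V H a))) u~x

-- Packing colourings of subgraphs

distance>-walk : ∀ {i} → Distance> G u v i → Walk G u v ℓ → i < ℓ
distance>-walk {G = G} far p =
  let d , isD = least (walk? G _ _) _ p in <-≤-trans (far d isD) (proj₂ isD _ p)

-- Walks of `H` are walks of `G`, so distances can only grow and the same colouring works.
colorable-mono : H ⊑ G → PackingColorable G k → PackingColorable H k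
colorable-mono H⊑G (c , pc) = c , record
  { range   = λ v v∈ → range v (proj₁ H⊑G v∈)
  ; packing = λ u v u∈ v∈ u≢v same d (p , _) →
      distance>-walk (packing u v (proj₁ H⊑G u∈) (proj₁ H⊑G v∈) u≢v same) (walk-mono H⊑G p)
  }
  where open IsPackingColoring pc

colorable-≤ : (G : Graph n) → m ≤ k → PackingColorable G m → PackingColorable G k
colorable-≤ G m≤k (c , pc) = c , record
  { range   = λ v v∈ → proj₁ (range v v∈) , ≤-trans (proj₂ (range v v∈)) m≤k
  ; packing = packing
  }
  where open IsPackingColoring pc

colorable-glue : (G : Graph n) → H ⊑ G → ¬ Reach H x y → (∀ {w} → w ∈ V H → Reach H w x ⊎ Reach H w y) →
                 PackingColorable (G - y) k → PackingColorable (G - x) k → PackingColorable H k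
colorable-glue {H = H} {x = x} {y = y} {k = k} G H⊑G x≁y side (c₁ , pc₁) (c₂ , pc₂) =
  c , record { range = range ; packing = λ u v u∈ v∈ u≢v same d (p , _) → packing u∈ v∈ u≢v same p }
  where
  module P₁ = IsPackingColoring pc₁
  module P₂ = IsPackingColoring pc₂

  Chosen : Fin _ → ℕ → Set
  Chosen w i = (Reach H w x × i ≡ c₁ w) ⊎ (Reach H w y × i ≡ c₂ w)

  -- A colour may not depend on a membership proof, so membership is decided here; the value 0
  -- outside `V H` is arbitrary.
  choose : ∀ w → ∃[ i ] (w ∈ V H → Chosen w i)
  choose w with w ∈? V H
  ... | no w∉V  = 0 , λ w∈V → contradiction w∈V w∉V
  ... | yes w∈V with side w∈V
  ...   | inj₁ w~x = c₁ w , λ _ → inj₁ (w~x , refl)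
  ...   | inj₂ w~y = c₂ w , λ _ → inj₂ (w~y , refl)

  c : Fin _ → ℕ
  c = proj₁ ∘ choose

  y≁x : ¬ Reach H y x
  y≁x = x≁y ∘ reach-sym

  -- The trivial walk at w serves to transfer membership of w.
  ∈₁ : ∀ {w} → w ∈ V H → Reach H w x → w ∈ V (G - y)
  ∈₁ w∈ w~x = start∈V (walk-avoiding G H⊑G x≁y w~x ([] w∈))

  ∈₂ : ∀ {w} → w ∈ V H → Reach H w y → w ∈ V (G - x)
  ∈₂ w∈ w~y = start∈V (walk-avoiding G H⊑G y≁x w~y ([] w∈))

  range : ∀ w → w ∈ V H → 1 ≤ c w × c w ≤ k
  range w w∈ with choose w
  ... | i , chosen with chosen w∈
  ...   | inj₁ (w~x , refl) = P₁.range w (∈₁ w∈ w~x)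
  ...   | inj₂ (w~y , refl) = P₂.range w (∈₂ w∈ w~y)

  packing : ∀ {u v d} → u ∈ V H → v ∈ V H → u ≢ v → c u ≡ c v → Walk H u v d → c u < d
  packing {u} {v} u∈ v∈ u≢v same p with choose u | choose v
  ... | _ , chosenᵘ | _ , chosenᵛ with chosenᵘ u∈ | chosenᵛ v∈
  ...   | inj₁ (u~x , refl) | inj₁ (v~x , refl) =
    distance>-walk (P₁.packing u v (∈₁ u∈ u~x) (∈₁ v∈ v~x) u≢v same) (walk-avoiding G H⊑G x≁y u~x p)
  ...   | inj₂ (u~y , refl) | inj₂ (v~y , refl) =
    distance>-walk (P₂.packing u v (∈₂ u∈ u~y) (∈₂ v∈ v~y) u≢v same) (walk-avoiding G H⊑G y≁x u~y p)
  -- On different sides, the walk `p` would join `x` to `y`, so no distance bound is left to prove.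
  ...   | inj₁ (u~x , _) | inj₂ (v~y , _) =
    contradiction (reach-trans (reach-sym u~x) (reach-trans (_ , p) v~y)) x≁y
  ...   | inj₂ (u~y , _) | inj₁ (v~x , _) =
    contradiction (reach-trans (reach-sym u~y) (reach-trans (_ , p) v~x)) y≁x

-- The packing chromatic number and criticality

χρ-colorable : (G : Graph n) → PackingColorable G (χρ G)
χρ-colorable G = proj₁ (χρ-isLeast G)

χρ-least : (G : Graph n) → PackingColorable G k → χρ G ≤ k
χρ-least G = proj₂ (χρ-isLeast G) _

χρ-mono : (H G : Graph n) → H ⊑ G → χρ H ≤ χρ G
χρ-mono H G H⊑G = χρ-least H (colorable-mono H⊑G (χρ-colorable G))

critical⇒vertexCritical : (G : Graph n) → Critical G → VertexCritical G
critical⇒vertexCritical G crit x x∈V = crit (G - x) (G-x⊏G G x∈V)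

χρ-deleteEdge : (T : Graph n) → IsTree T → Adj T x y →
                χρ (deleteEdge T x y) ≤ χρ (T - x) ⊔ χρ (T - y)
χρ-deleteEdge {x = x} {y = y} T tree xy = χρ-least (deleteEdge T x y)
  (colorable-glue T (deleteEdge⊑ T)
    (deleteEdge-separates T acyclic xy)
    (λ w∈V → deleteEdge-sides T y∈V (proj₂ (connected w∈V (Adj⇒∈V T xy))))
    -- Gluing needs one common number of colours, so both optimal colourings are relaxed to the
    -- maximum.
    (colorable-≤ (T - y) (m≤n⊔m (χρ (T - x)) (χρ (T - y))) (χρ-colorable (T - y)))
    (colorable-≤ (T - x) (m≤m⊔n (χρ (T - x)) (χρ (T - y))) (χρ-colorable (T - x))))
  where
  open IsTree tree
  y∈V = Adj⇒∈V T (Adj-sym T xy)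

vertexCritical⇒critical : (T : Graph n) → IsTree T → VertexCritical T → Critical T
vertexCritical⇒critical T tree vcrit H H⊏T@(H⊑T , _) with ⊏-missing H T H⊏T
... | inj₁ (x , x∈V , x∉H) =
  ≤-<-trans (χρ-mono H (T - x) (⊑-deleteVertex H T H⊑T x∉H)) (vcrit x x∈V)
... | inj₂ (x , y , xy , ¬xy) =
  ≤-<-trans (χρ-mono H (deleteEdge T x y) (⊑-deleteEdge H T H⊑T ¬xy))
    (≤-<-trans (χρ-deleteEdge T tree xy)
      (⊔-pres-<m (vcrit x (Adj⇒∈V T xy)) (vcrit y (Adj⇒∈V T (Adj-sym T xy)))))

theorem3p5 : ∀ {n : ℕ} (T : Graph n) → IsTree T → Critical T ⇔ VertexCritical T
theorem3p5 T tree = mk⇔ (critical⇒vertexCritical T) (vertexCritical⇒critical T tree)
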